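{- For all $n\ge1$, the multiplexer function $\mathsf{MUX}_n$ has a hazard-free De Morgan formula of depth $2n+1$ and size at most $2.25\cdot3^n-\frac n2-1.25$.
   Context: $\mathsf{MUX}_n\colon\{0,1\}^{n+2^n}\to\{0,1\}$ is $\mathsf{MUX}_n(s_1,\dots,s_n,x_0,\dots,x_{2^n-1})=x_{\mathrm{bin}(s_1,\dots,s_n)}$, where $\mathrm{bin}(s_1,\dots,s_n)$ is the natural number with binary representation $s_1s_2\cdots s_n$. Three-valued logic: let $\mathsf u$ be a third symbol, thought of as $\tfrac12$, so $0<\mathsf u<1$; $x\wedge y=\min(x,y)$, $x\vee y=\max(x,y)$, $\neg x=1-x$ on $\{0,\mathsf u,1\}$. A resolution of $\alpha\in\{0,\mathsf u,1\}^m$ is a string $a\in\{0,1\}^m$ with $a_i=\alpha_i$ whenever $\alpha_i\ne\mathsf u$. The hazard-free extension $\tilde f$ of $f\colon\{0,1\}^m\to\{0,1\}$ is: $\tilde f(\alpha)=c\in\{0,1\}$ if $f(a)=c$ for all resolutions $a$ of $\alpha$, and $\tilde f(\alpha)=\mathsf u$ otherwise. A De Morgan formula is a binary tree whose internal nodes are labeled $\vee$ or $\wedge$ (fan-in two) and whose leaves are labeled by literals (a variable or its negation), evaluated on $\{0,\mathsf u,1\}$-inputs by the rules above. Size is the number of leaves; depth is the length (number of edges) of the longest root-to-leaf path. A formula $F$ computing $f$ is hazard-free if $F(\alpha)=\tilde f(\alpha)$ for all $\alpha\in\{0,\mathsf u,1\}^m$. -}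

module Defs where

open import Data.Bool using (Bool; true; false; if_then_else_)
import Data.Bool.Properties as Bool
open import Data.Fin using (Fin; fromℕ<)
import Data.Fin.Properties as Fin
open import Data.Nat using (ℕ; zero; suc; _+_; _^_; _<_; _⊔_; z<s)
open import Data.Nat.Properties using (+-monoʳ-<; <-≤-trans; m≤m+n)
open import Data.Vec using (Vec; []; _∷_; lookup; map; take; drop)
open import Relation.Binary.PropositionalEquality using (_≡_; _≢_; refl)
open import Relation.Nullary using (Dec; yes; no; does; ¬?)
open import Relation.Nullary.Decidable using (_→-dec_; map′; _×-dec_)
open import Relation.Binary using (DecidableEquality)
open import Data.Product using (_×_; _,_)

data Trit : Set where
  𝟎 𝐮 𝟏 : Trit

_≟₃_ : DecidableEquality Trit
𝟎 ≟₃ 𝟎 = yes refl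
𝟎 ≟₃ 𝐮 = no λ ()
𝟎 ≟₃ 𝟏 = no λ ()
𝐮 ≟₃ 𝟎 = no λ ()
𝐮 ≟₃ 𝐮 = yes refl
𝐮 ≟₃ 𝟏 = no λ ()
𝟏 ≟₃ 𝟎 = no λ ()
𝟏 ≟₃ 𝐮 = no λ ()
𝟏 ≟₃ 𝟏 = yes refl

infixr 6 _∧₃_
infixr 5 _∨₃_

-- The connectives are min, max and x ↦ 1 − x for 𝟎 < 𝐮 = ½ < 𝟏.
_∧₃_ : Trit → Trit → Trit
𝟎 ∧₃ _ = 𝟎
𝐮 ∧₃ 𝟎 = 𝟎
𝐮 ∧₃ 𝐮 = 𝐮
𝐮 ∧₃ 𝟏 = 𝐮
𝟏 ∧₃ y = y

_∨₃_ : Trit → Trit → Trit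
𝟎 ∨₃ y = y
𝐮 ∨₃ 𝟎 = 𝐮
𝐮 ∨₃ 𝐮 = 𝐮
𝐮 ∨₃ 𝟏 = 𝟏
𝟏 ∨₃ _ = 𝟏

¬₃_ : Trit → Trit
¬₃ 𝟎 = 𝟏
¬₃ 𝐮 = 𝐮
¬₃ 𝟏 = 𝟎

⌜_⌝ : Bool → Trit
⌜ false ⌝ = 𝟎
⌜ true  ⌝ = 𝟏

IsResolution : ∀ {m} → Vec Trit m → Vec Bool m → Set
IsResolution α a = ∀ i → lookup α i ≢ 𝐮 → ⌜ lookup a i ⌝ ≡ lookup α i

isResolution? : ∀ {m} (α : Vec Trit m) (a : Vec Bool m) → Dec (IsResolution α a)
isResolution? α a =
  Fin.all? λ i → ¬? (lookup α i ≟₃ 𝐮) →-dec (⌜ lookup a i ⌝ ≟₃ lookup α i)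

allStrings? : ∀ {m} {P : Vec Bool m → Set} → (∀ a → Dec (P a)) → Dec (∀ a → P a)
allStrings? {zero}  P? = map′ (λ p → λ { [] → p }) (λ h → h []) (P? [])
allStrings? {suc m} P? =
  map′ (λ (p , q) → λ { (false ∷ a) → p a ; (true ∷ a) → q a })
       (λ h → (λ a → h (false ∷ a)) , (λ a → h (true ∷ a)))
       (allStrings? (λ a → P? (false ∷ a)) ×-dec allStrings? (λ a → P? (true ∷ a)))

ConstantOnResolutions : ∀ {m} → (Vec Bool m → Bool) → Vec Trit m → Bool → Set
ConstantOnResolutions f α c = ∀ a → IsResolution α a → f a ≡ c

constantOnResolutions? : ∀ {m} (f : Vec Bool m → Bool) (α : Vec Trit m) (c : Bool) →
                         Dec (ConstantOnResolutions f α c)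
constantOnResolutions? f α c =
  allStrings? λ a → isResolution? α a →-dec (f a Bool.≟ c)

-- Every α has a resolution, so at most one of the two tests succeeds and their
-- order is immaterial.
hazardFreeExtension : ∀ {m} → (Vec Bool m → Bool) → Vec Trit m → Trit
hazardFreeExtension f α =
  if does (constantOnResolutions? f α false) then 𝟎
  else if does (constantOnResolutions? f α true) then 𝟏
  else 𝐮

data Literal (m : ℕ) : Set where
  pos neg : Fin m → Literal m

data Formula (m : ℕ) : Set where
  leaf      : Literal m → Formula m
  _∧ᶠ_ _∨ᶠ_ : Formula m → Formula m → Formula m

evalLiteral : ∀ {m} → Literal m → Vec Trit m → Trit
evalLiteral (pos i) α = lookup α i
evalLiteral (neg i) α = ¬₃ lookup α i

eval : ∀ {m} → Formula m → Vec Trit m → Trit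
eval (leaf l)  α = evalLiteral l α
eval (F ∧ᶠ G) α = eval F α ∧₃ eval G α
eval (F ∨ᶠ G) α = eval F α ∨₃ eval G α

size : ∀ {m} → Formula m → ℕ
size (leaf _)  = 1
size (F ∧ᶠ G) = size F + size G
size (F ∨ᶠ G) = size F + size G

depth : ∀ {m} → Formula m → ℕ
depth (leaf _)  = 0
depth (F ∧ᶠ G) = suc (depth F ⊔ depth G)
depth (F ∨ᶠ G) = suc (depth F ⊔ depth G)

_Computes_ : ∀ {m} → Formula m → (Vec Bool m → Bool) → Set
F Computes f = ∀ a → eval F (map ⌜_⌝ a) ≡ ⌜ f a ⌝

_IsHazardFreeFor_ : ∀ {m} → Formula m → (Vec Bool m → Bool) → Set
F IsHazardFreeFor f = F Computes f × (∀ α → eval F α ≡ hazardFreeExtension f α)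

-- The head of the vector is the most significant bit.
bin : ∀ {n} → Vec Bool n → ℕ
bin []                  = 0
bin {suc n} (false ∷ s) = bin s
bin {suc n} (true  ∷ s) = 2 ^ n + bin s

bin<2^n : ∀ {n} (s : Vec Bool n) → bin s < 2 ^ n
bin<2^n []                  = z<s
bin<2^n {suc n} (false ∷ s) = <-≤-trans (bin<2^n s) (m≤m+n (2 ^ n) _)
bin<2^n {suc n} (true  ∷ s) =
  +-monoʳ-< (2 ^ n) (<-≤-trans (bin<2^n s) (m≤m+n (2 ^ n) 0))

MUX : ∀ n → Vec Bool (n + 2 ^ n) → Bool
MUX n a = lookup (drop n a) (fromℕ< (bin<2^n (take n a)))

{-# OPTIONS --safe #-}
module Submission where

-- Split on the first selector s, and let x and y be the multiplexers of the two
-- halves. The formula (x ∧ (¬s ∨ y)) ∨ (s ∧ y) contains all three prime implicants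
-- ¬s ∧ x, s ∧ y and x ∧ y, so it is hazard-free when x and y are, but ¬s ∨ y costs
-- depth 3 per level. To pay only 2, replace ¬s ∨ y by a formula for "literal or
-- multiplexer" of the same depth 2n + 1, in which the literal l is pushed down by
--   l ∨ (x ∧ (¬s ∨ y)) ∨ (s ∧ y) = (x ∧ (¬s ∨ y)) ∨ ((l ∨ s) ∧ (l ∨ y)).
-- This takes one extra leaf per level, n + 1 in all, and S(n+1) = 3 S(n) + n + 2
-- with S(0) = 1 solves to 4 S(n) + 2n + 5 = 9 · 3ⁿ.

open import Data.Bool using (Bool; true; false; if_then_else_)
open import Data.Fin using (Fin; zero; suc; fromℕ<; _↑ˡ_; _↑ʳ_; splitAt)
open import Data.Fin.Properties using (splitAt⁻¹-↑ˡ; splitAt⁻¹-↑ʳ)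
open import Data.Integer using (+_)
import Data.Integer as ℤ
import Data.Integer.Properties as ℤ
import Data.Integer.Tactic.RingSolver as ℤ-Solver
open import Data.Nat using (ℕ; zero; suc; _+_; _*_; _^_; _≥_; _≤_; z≤n)
import Data.Nat.Properties as ℕ
import Data.Nat.Tactic.RingSolver as ℕ-Solver
open import Data.Product using (_×_; _,_; proj₁; proj₂; Σ-syntax; ∃-syntax)
open import Data.Rational as ℚ using (_/_; toℚᵘ)
import Data.Rational.Properties as ℚ
open import Data.Rational.Unnormalised as ℚᵘ using (mkℚᵘ; *≡*)
import Data.Rational.Unnormalised.Properties as ℚᵘ
open import Data.Sum using (inj₁; inj₂)
open import Data.Vec using (Vec; []; _∷_; lookup; map; _++_; take; drop)
open import Data.Vec.Properties using (lookup-map; lookup-++ˡ; lookup-++ʳ; ++-injectiveˡ; take++drop≡id)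
open import Function using (_∘_)
open import Relation.Binary.PropositionalEquality
  using (_≡_; _≢_; refl; sym; trans; cong; cong₂; subst; module ≡-Reasoning)
open import Relation.Nullary.Negation using (contradiction)
open import Relation.Nullary.Decidable using (dec-true; dec-false)
open import Defs

-- Information order and values of the hazard-free extension

private
  variable
    m n : ℕ

-- Information order: IsResolution α a unfolds to the pointwise ⌜ a ⌝ ⊑ α.
infix 4 _⊑_
_⊑_ : Trit → Trit → Set
x ⊑ y = y ≢ 𝐮 → x ≡ y

⊑-trans : ∀ {x y z} → x ⊑ y → y ⊑ z → x ⊑ z
⊑-trans x⊑y y⊑z z≢𝐮 with refl ← y⊑z z≢𝐮 = x⊑y z≢𝐮

𝐮-top : ∀ {x} → x ⊑ 𝐮
𝐮-top 𝐮≢𝐮 = contradiction refl 𝐮≢𝐮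

⌜⌝-injective : ∀ {b c} → ⌜ b ⌝ ≡ ⌜ c ⌝ → b ≡ c
⌜⌝-injective {false} {false} _ = refl
⌜⌝-injective {true}  {true}  _ = refl

⌜_⌝≢𝐮 : ∀ b → ⌜ b ⌝ ≢ 𝐮
⌜ false ⌝≢𝐮 ()
⌜ true  ⌝≢𝐮 ()

-- The two hypotheses make `v` the least upper bound, in the information order, of the values of `f`
-- on resolutions. The first forces constancy when `v` is Boolean; the second supplies witnesses
-- refuting the tests that must fail, both of them when `v` is `𝐮`.
hazardFreeExtension-unique :
  ∀ (f : Vec Bool m → Bool) α v →
  (∀ a → IsResolution α a → ⌜ f a ⌝ ⊑ v) →
  (∀ c → ⌜ c ⌝ ⊑ v → ∃[ a ] IsResolution α a × f a ≡ c) →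
  hazardFreeExtension f α ≡ v
hazardFreeExtension-unique f α 𝟎 sound _
  rewrite dec-true (constantOnResolutions? f α false)
            (λ a r → ⌜⌝-injective (sound a r λ ())) = refl
hazardFreeExtension-unique f α 𝟏 sound attained
  with a , r , fa≡true ← attained true (λ _ → refl)
  rewrite dec-false (constantOnResolutions? f α false)
            (λ h → contradiction (trans (sym fa≡true) (h a r)) λ ())
        | dec-true (constantOnResolutions? f α true)
            (λ a r → ⌜⌝-injective (sound a r λ ())) = refl
hazardFreeExtension-unique f α 𝐮 _ attained
  with a , r , fa≡true  ← attained true  𝐮-top
     | b , s , fb≡false ← attained false 𝐮-top
  rewrite dec-false (constantOnResolutions? f α false)
            (λ h → contradiction (trans (sym fa≡true) (h a r)) λ ())
        | dec-false (constantOnResolutions? f α true)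
            (λ h → contradiction (trans (sym (h b s)) fb≡false) λ ()) = refl

resolution-of-string : ∀ {a b : Vec Bool m} → IsResolution (map ⌜_⌝ a) b → b ≡ a
resolution-of-string {a = []}    {[]}    _ = refl
resolution-of-string {a = x ∷ a} {y ∷ b} r =
  cong₂ _∷_ (⌜⌝-injective (r zero ⌜ x ⌝≢𝐮)) (resolution-of-string (r ∘ suc))

self-resolution : ∀ (a : Vec Bool m) → IsResolution (map ⌜_⌝ a) a
self-resolution a i _ = sym (lookup-map i ⌜_⌝ a)

-- A Boolean string is its own only resolution. This reduces `Computes` to agreement with the
-- extension on ternary inputs.
hazardFreeExtension-⌜⌝ : ∀ (f : Vec Bool m → Bool) a →
                         hazardFreeExtension f (map ⌜_⌝ a) ≡ ⌜ f a ⌝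
hazardFreeExtension-⌜⌝ f a = hazardFreeExtension-unique f (map ⌜_⌝ a) ⌜ f a ⌝
  (λ b r _ → cong (⌜_⌝ ∘ f) (resolution-of-string r))
  (λ c c⊑fa → a , self-resolution a , sym (⌜⌝-injective (c⊑fa ⌜ f a ⌝≢𝐮)))

-- The three-valued selector and its iteration

select : Trit → Trit → Trit → Trit
select s x y = (x ∧₃ (¬₃ s ∨₃ y)) ∨₃ (s ∧₃ y)

select-𝟎 : ∀ x y → select 𝟎 x y ≡ x
select-𝟎 𝟎 y = refl
select-𝟎 𝐮 y = refl
select-𝟎 𝟏 y = refl

select-𝟏 : ∀ x y → select 𝟏 x y ≡ y
select-𝟏 𝟎 y = refl
select-𝟏 𝐮 𝟎 = refl
select-𝟏 𝐮 𝐮 = refl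
select-𝟏 𝐮 𝟏 = refl
select-𝟏 𝟏 𝟎 = refl
select-𝟏 𝟏 𝐮 = refl
select-𝟏 𝟏 𝟏 = refl

-- With `s` undetermined, the value is Boolean only if `x` and `y` are the same Boolean, and then
-- both branches return it; this is where the prime implicant `x ∧ y` matters.
select-⊑ : ∀ b {s} x y → ⌜ b ⌝ ⊑ s → (if b then y else x) ⊑ select s x y
select-⊑ false {𝟎} x y _   = λ _ → sym (select-𝟎 x y)
select-⊑ true  {𝟎} x y b⊑s with () ← b⊑s (λ ())
select-⊑ false {𝟏} x y b⊑s with () ← b⊑s (λ ())
select-⊑ true  {𝟏} x y _   = λ _ → sym (select-𝟏 x y)
select-⊑ false {𝐮} 𝟎 𝟎 _ = λ _ → refl
select-⊑ true  {𝐮} 𝟎 𝟎 _ = λ _ → refl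
select-⊑ b     {𝐮} 𝟎 𝐮 _ = 𝐮-top
select-⊑ b     {𝐮} 𝟎 𝟏 _ = 𝐮-top
select-⊑ b     {𝐮} 𝐮 𝟎 _ = 𝐮-top
select-⊑ b     {𝐮} 𝐮 𝐮 _ = 𝐮-top
select-⊑ b     {𝐮} 𝐮 𝟏 _ = 𝐮-top
select-⊑ b     {𝐮} 𝟏 𝟎 _ = 𝐮-top
select-⊑ b     {𝐮} 𝟏 𝐮 _ = 𝐮-top
select-⊑ false {𝐮} 𝟏 𝟏 _ = λ _ → refl
select-⊑ true  {𝐮} 𝟏 𝟏 _ = λ _ → refl

-- With `s` undetermined the branch is free: take an input that is `𝐮` if there is one, since every
-- value lies below it, and otherwise an input equal to `⌜ c ⌝`.
select-attained : ∀ c s x y → ⌜ c ⌝ ⊑ select s x y →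
                  ∃[ b ] ⌜ b ⌝ ⊑ s × ⌜ c ⌝ ⊑ (if b then y else x)
select-attained c 𝟎 x y c⊑v = false , (λ _ → refl) , subst (⌜ c ⌝ ⊑_) (select-𝟎 x y) c⊑v
select-attained c 𝟏 x y c⊑v = true  , (λ _ → refl) , subst (⌜ c ⌝ ⊑_) (select-𝟏 x y) c⊑v
select-attained c     𝐮 𝐮 y _   = false , 𝐮-top , 𝐮-top
select-attained c     𝐮 x 𝐮 _   = true  , 𝐮-top , 𝐮-top
select-attained c     𝐮 𝟎 𝟎 c⊑v = false , 𝐮-top , c⊑v
select-attained false 𝐮 𝟎 𝟏 _   = false , 𝐮-top , λ _ → refl
select-attained true  𝐮 𝟎 𝟏 _   = true  , 𝐮-top , λ _ → refl
select-attained false 𝐮 𝟏 𝟎 _   = true  , 𝐮-top , λ _ → refl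
select-attained true  𝐮 𝟏 𝟎 _   = false , 𝐮-top , λ _ → refl
select-attained c     𝐮 𝟏 𝟏 c⊑v = true  , 𝐮-top , c⊑v

-- Data are indexed by bit strings, not by numbers below `2 ^ n`, so that passing to a half is
-- precomposition with a prefix and needs no arithmetic on `bin`.
mux₃ : (Fin n → Trit) → (Vec Bool n → Trit) → Trit
mux₃ {zero}  s x = x []
mux₃ {suc n} s x =
  select (s zero) (mux₃ (s ∘ suc) (x ∘ (false ∷_))) (mux₃ (s ∘ suc) (x ∘ (true ∷_)))

mux₃-⊑ : ∀ {s : Fin n → Trit} x p → (∀ i → ⌜ lookup p i ⌝ ⊑ s i) → x p ⊑ mux₃ s x
mux₃-⊑ x []          r = λ _ → refl
mux₃-⊑ x (false ∷ p) r =
  ⊑-trans (mux₃-⊑ (x ∘ (false ∷_)) p (r ∘ suc)) (select-⊑ false _ _ (r zero))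
mux₃-⊑ x (true  ∷ p) r =
  ⊑-trans (mux₃-⊑ (x ∘ (true ∷_)) p (r ∘ suc)) (select-⊑ true _ _ (r zero))

mux₃-attained : ∀ c (s : Fin n → Trit) x → ⌜ c ⌝ ⊑ mux₃ s x →
                ∃[ p ] (∀ i → ⌜ lookup p i ⌝ ⊑ s i) × ⌜ c ⌝ ⊑ x p
mux₃-attained {zero}  c s x c⊑v = [] , (λ ()) , c⊑v
mux₃-attained {suc n} c s x c⊑v with select-attained c (s zero) _ _ c⊑v
... | false , b⊑s , c⊑x =
  let p , r , c⊑xp = mux₃-attained c (s ∘ suc) (x ∘ (false ∷_)) c⊑x
  in false ∷ p , (λ { zero → b⊑s ; (suc i) → r i }) , c⊑xp
... | true  , b⊑s , c⊑y =
  let p , r , c⊑xp = mux₃-attained c (s ∘ suc) (x ∘ (true ∷_)) c⊑y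
  in true ∷ p , (λ { zero → b⊑s ; (suc i) → r i }) , c⊑xp

-- The hazard-free extension of the multiplexer

address : Vec Bool n → Fin (2 ^ n)
address p = fromℕ< (bin<2^n p)

take-++ : ∀ {A : Set} (xs : Vec A m) (ys : Vec A n) → take m (xs ++ ys) ≡ xs
take-++ {m = m} xs ys = ++-injectiveˡ _ _ (take++drop≡id m (xs ++ ys))

lookup-take : ∀ {A : Set} m (xs : Vec A (m + n)) i → lookup (take m xs) i ≡ lookup xs (i ↑ˡ n)
lookup-take m xs i = trans (sym (lookup-++ˡ (take m xs) (drop m xs) i))
                           (cong (λ v → lookup v (i ↑ˡ _)) (take++drop≡id m xs))

lookup-drop : ∀ {A : Set} m (xs : Vec A (m + n)) i → lookup (drop m xs) i ≡ lookup xs (m ↑ʳ i)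
lookup-drop m xs i = trans (sym (lookup-++ʳ (take m xs) (drop m xs) i))
                           (cong (λ v → lookup v (m ↑ʳ i)) (take++drop≡id m xs))

MUX-lookup : ∀ n a → MUX n a ≡ lookup a (n ↑ʳ address (take n a))
MUX-lookup n a = lookup-drop n a _

resolve : Bool → Trit → Bool
resolve c 𝟎 = false
resolve c 𝐮 = c
resolve c 𝟏 = true

resolve-⊑ : ∀ c x → ⌜ resolve c x ⌝ ⊑ x
resolve-⊑ c 𝟎 _ = refl
resolve-⊑ c 𝐮   = 𝐮-top
resolve-⊑ c 𝟏 _ = refl

resolve-attains : ∀ c x → ⌜ c ⌝ ⊑ x → resolve c x ≡ c
resolve-attains c 𝟎 c⊑x = sym (⌜⌝-injective (c⊑x λ ()))
resolve-attains c 𝐮 _   = refl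
resolve-attains c 𝟏 c⊑x = sym (⌜⌝-injective (c⊑x λ ()))

++-resolution : ∀ {p : Vec Bool m} {q : Vec Bool n} {α} →
                (∀ i → ⌜ lookup p i ⌝ ⊑ lookup α (i ↑ˡ n)) →
                (∀ i → ⌜ lookup q i ⌝ ⊑ lookup α (m ↑ʳ i)) →
                IsResolution α (p ++ q)
++-resolution {m} {n} {p} {q} {α} rp rq i with splitAt m i in eq
... | inj₁ j rewrite sym (splitAt⁻¹-↑ˡ eq) | lookup-++ˡ p q j = rp j
... | inj₂ j rewrite sym (splitAt⁻¹-↑ʳ eq) | lookup-++ʳ p q j = rq j

-- Selectors and data are disjoint blocks of variables, so they can be resolved independently: first
-- an address compatible with the selectors, then the data.
mux₃-hazardFree : ∀ n α →
  hazardFreeExtension (MUX n) α ≡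
  mux₃ (λ i → lookup α (i ↑ˡ 2 ^ n)) (λ p → lookup α (n ↑ʳ address p))
mux₃-hazardFree n α = hazardFreeExtension-unique (MUX n) α _ sound attained
  where
  s = λ i → lookup α (i ↑ˡ 2 ^ n)
  x = λ p → lookup α (n ↑ʳ address p)

  sound : ∀ a → IsResolution α a → ⌜ MUX n a ⌝ ⊑ mux₃ s x
  sound a r = ⊑-trans
    (subst (λ b → ⌜ b ⌝ ⊑ x (take n a)) (sym (MUX-lookup n a)) (r _))
    (mux₃-⊑ x (take n a) λ i →
      subst (λ b → ⌜ b ⌝ ⊑ s i) (sym (lookup-take n a i)) (r _))

  attained : ∀ c → ⌜ c ⌝ ⊑ mux₃ s x → ∃[ a ] IsResolution α a × MUX n a ≡ c
  attained c c⊑v = p ++ q , ++-resolution {p = p} {q} {α} (proj₁ (proj₂ attaining)) rq , MUX≡c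
    where
    attaining = mux₃-attained c s x c⊑v
    p = proj₁ attaining
    -- The datum at address `p` is `𝐮` or already `⌜ c ⌝`, so filling every undetermined datum with
    -- `c` puts `c` there.
    q = map (resolve c) (drop n α)

    lookup-q : ∀ i → lookup q i ≡ resolve c (lookup α (n ↑ʳ i))
    lookup-q i = trans (lookup-map i (resolve c) (drop n α)) (cong (resolve c) (lookup-drop n α i))

    rq : ∀ i → ⌜ lookup q i ⌝ ⊑ lookup α (n ↑ʳ i)
    rq i rewrite lookup-q i = resolve-⊑ c _

    open ≡-Reasoning
    MUX≡c : MUX n (p ++ q) ≡ c
    MUX≡c = begin
      MUX n (p ++ q)
        ≡⟨ MUX-lookup n (p ++ q) ⟩
      lookup (p ++ q) (n ↑ʳ address (take n (p ++ q)))
        ≡⟨ cong (λ t → lookup (p ++ q) (n ↑ʳ address t)) (take-++ p q) ⟩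
      lookup (p ++ q) (n ↑ʳ address p)
        ≡⟨ lookup-++ʳ p q (address p) ⟩
      lookup q (address p)
        ≡⟨ lookup-q (address p) ⟩
      resolve c (x p)
        ≡⟨ resolve-attains c (x p) (proj₂ (proj₂ attaining)) ⟩
      c ∎

-- The formulas and their values

mutual
  muxᶠ : (Fin n → Fin m) → (Vec Bool n → Fin m) → Formula m
  muxᶠ {zero}  s x = leaf (pos (x []))
  muxᶠ {suc n} s x =
    (muxᶠ (s ∘ suc) (x ∘ (false ∷_)) ∧ᶠ ormuxᶠ (neg (s zero)) (s ∘ suc) (x ∘ (true ∷_)))
      ∨ᶠ (leaf (pos (s zero)) ∧ᶠ muxᶠ (s ∘ suc) (x ∘ (true ∷_)))

  ormuxᶠ : Literal m → (Fin n → Fin m) → (Vec Bool n → Fin m) → Formula m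
  ormuxᶠ {n = zero}  l s x = leaf l ∨ᶠ leaf (pos (x []))
  ormuxᶠ {n = suc n} l s x =
    (muxᶠ (s ∘ suc) (x ∘ (false ∷_)) ∧ᶠ ormuxᶠ (neg (s zero)) (s ∘ suc) (x ∘ (true ∷_)))
      ∨ᶠ ((leaf l ∨ᶠ leaf (pos (s zero))) ∧ᶠ ormuxᶠ l (s ∘ suc) (x ∘ (true ∷_)))

∨₃-distribˡ-∧₃ : ∀ x y z → x ∨₃ (y ∧₃ z) ≡ (x ∨₃ y) ∧₃ (x ∨₃ z)
∨₃-distribˡ-∧₃ 𝟎 y z = refl
∨₃-distribˡ-∧₃ 𝟏 y z = refl
∨₃-distribˡ-∧₃ 𝐮 𝟎 𝟎 = refl
∨₃-distribˡ-∧₃ 𝐮 𝟎 𝐮 = refl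
∨₃-distribˡ-∧₃ 𝐮 𝟎 𝟏 = refl
∨₃-distribˡ-∧₃ 𝐮 𝐮 𝟎 = refl
∨₃-distribˡ-∧₃ 𝐮 𝐮 𝐮 = refl
∨₃-distribˡ-∧₃ 𝐮 𝐮 𝟏 = refl
∨₃-distribˡ-∧₃ 𝐮 𝟏 𝟎 = refl
∨₃-distribˡ-∧₃ 𝐮 𝟏 𝐮 = refl
∨₃-distribˡ-∧₃ 𝐮 𝟏 𝟏 = refl

∨₃-swap : ∀ x y z → x ∨₃ (y ∨₃ z) ≡ y ∨₃ (x ∨₃ z)
∨₃-swap 𝟎 y z = refl
∨₃-swap x 𝟎 z = refl
∨₃-swap 𝐮 𝐮 z = refl
∨₃-swap 𝐮 𝟏 𝟎 = refl
∨₃-swap 𝐮 𝟏 𝐮 = refl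
∨₃-swap 𝐮 𝟏 𝟏 = refl
∨₃-swap 𝟏 𝐮 𝟎 = refl
∨₃-swap 𝟏 𝐮 𝐮 = refl
∨₃-swap 𝟏 𝐮 𝟏 = refl
∨₃-swap 𝟏 𝟏 z = refl

-- Distributivity collects the two copies of `l` into `l ∨ (s ∧ y)`; then `l` moves past the first
-- disjunct.
∨₃-select : ∀ l s x y →
            (x ∧₃ (¬₃ s ∨₃ y)) ∨₃ ((l ∨₃ s) ∧₃ (l ∨₃ y)) ≡ l ∨₃ select s x y
∨₃-select l s x y rewrite sym (∨₃-distribˡ-∧₃ l s y) =
  ∨₃-swap (x ∧₃ (¬₃ s ∨₃ y)) l (s ∧₃ y)

mutual
  eval-muxᶠ : ∀ (s : Fin n → Fin m) x α →
              eval (muxᶠ s x) α ≡ mux₃ (lookup α ∘ s) (lookup α ∘ x)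
  eval-muxᶠ {zero}  s x α = refl
  eval-muxᶠ {suc n} s x α
    rewrite eval-muxᶠ (s ∘ suc) (x ∘ (false ∷_)) α
          | eval-muxᶠ (s ∘ suc) (x ∘ (true ∷_)) α
          | eval-ormuxᶠ (neg (s zero)) (s ∘ suc) (x ∘ (true ∷_)) α = refl

  eval-ormuxᶠ : ∀ l (s : Fin n → Fin m) x α →
                eval (ormuxᶠ l s x) α ≡
                evalLiteral l α ∨₃ mux₃ (lookup α ∘ s) (lookup α ∘ x)
  eval-ormuxᶠ {zero}  l s x α = refl
  eval-ormuxᶠ {suc n} l s x α
    rewrite eval-muxᶠ (s ∘ suc) (x ∘ (false ∷_)) α
          | eval-ormuxᶠ l (s ∘ suc) (x ∘ (true ∷_)) α
          | eval-ormuxᶠ (neg (s zero)) (s ∘ suc) (x ∘ (true ∷_)) α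
    = ∨₃-select (evalLiteral l α) (lookup α (s zero)) _ _

-- Depth and size

2+[2n+1]≡2[1+n]+1 : ∀ n → suc (suc (2 * n + 1)) ≡ 2 * suc n + 1
2+[2n+1]≡2[1+n]+1 = ℕ-Solver.solve-∀

mutual
  -- Without selectors `muxᶠ` is a leaf of depth 0, not 1, so equality starts at one selector. The
  -- `ormuxᶠ` subformula has exact depth at every level and dominates the others, for which an upper
  -- bound suffices.
  depth-muxᶠ-suc : ∀ (s : Fin (suc n) → Fin m) x → depth (muxᶠ s x) ≡ 2 * suc n + 1
  depth-muxᶠ-suc {n} s x
    rewrite depth-ormuxᶠ (neg (s zero)) (s ∘ suc) (x ∘ (true ∷_))
          | ℕ.m≤n⇒m⊔n≡n (depth-muxᶠ-≤ (s ∘ suc) (x ∘ (false ∷_)))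
          | ℕ.m≥n⇒m⊔n≡m (depth-muxᶠ-≤ (s ∘ suc) (x ∘ (true ∷_)))
    = 2+[2n+1]≡2[1+n]+1 n

  depth-muxᶠ-≤ : ∀ (s : Fin n → Fin m) x → depth (muxᶠ s x) ≤ 2 * n + 1
  depth-muxᶠ-≤ {zero}  s x = z≤n
  depth-muxᶠ-≤ {suc n} s x = ℕ.≤-reflexive (depth-muxᶠ-suc s x)

  depth-ormuxᶠ : ∀ l (s : Fin n → Fin m) x → depth (ormuxᶠ l s x) ≡ 2 * n + 1
  depth-ormuxᶠ {zero}  l s x = refl
  depth-ormuxᶠ {suc n} l s x
    rewrite depth-ormuxᶠ (neg (s zero)) (s ∘ suc) (x ∘ (true ∷_))
          | depth-ormuxᶠ l (s ∘ suc) (x ∘ (true ∷_))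
          | ℕ.m≤n⇒m⊔n≡n (depth-muxᶠ-≤ (s ∘ suc) (x ∘ (false ∷_)))
          -- The disjunction of `l` and the selector has depth 1, so it fits beside the recursive
          -- formula.
          | ℕ.m≤n⇒m⊔n≡n (ℕ.m≤n+m 1 (2 * n))
          | ℕ.⊔-idem (2 * n + 1)
    = 2+[2n+1]≡2[1+n]+1 n

-- Both formulas share their first disjunct. In the second, the new leaf `l` counts once and the
-- recursive call adds one leaf for each remaining level and one at the base.
size-ormuxᶠ : ∀ l (s : Fin n → Fin m) x → size (ormuxᶠ l s x) ≡ size (muxᶠ s x) + suc n
size-ormuxᶠ {zero}  l s x = refl
size-ormuxᶠ {suc n} l s x
  rewrite size-ormuxᶠ l (s ∘ suc) (x ∘ (true ∷_)) =
  regroup (size (muxᶠ (s ∘ suc) (x ∘ (false ∷_))) + size (ormuxᶠ (neg (s zero)) (s ∘ suc) (x ∘ (true ∷_))))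
          (size (muxᶠ (s ∘ suc) (x ∘ (true ∷_)))) n
  where
  regroup : ∀ a b n → a + (2 + (b + suc n)) ≡ a + (1 + b) + suc (suc n)
  regroup = ℕ-Solver.solve-∀

-- Clearing denominators and moving the negative terms across keeps the induction within the
-- naturals.
size-muxᶠ : ∀ (s : Fin n → Fin m) x → 4 * size (muxᶠ s x) + 2 * n + 5 ≡ 9 * 3 ^ n
size-muxᶠ {zero}  s x = refl
size-muxᶠ {suc n} s x
  rewrite size-ormuxᶠ (neg (s zero)) (s ∘ suc) (x ∘ (true ∷_)) = begin
  4 * (a + (b + suc n) + (1 + b)) + 2 * suc n + 5
    -- The `true` half occurs twice, once with a literal absorbed, hence the weight 2 on its
    -- induction hypothesis.
    ≡⟨ regroup a b n ⟩
  (4 * a + 2 * n + 5) + 2 * (4 * b + 2 * n + 5)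
    ≡⟨ cong₂ (λ u v → u + 2 * v) (size-muxᶠ (s ∘ suc) _) (size-muxᶠ (s ∘ suc) _) ⟩
  9 * 3 ^ n + 2 * (9 * 3 ^ n)
    ≡⟨ collect (3 ^ n) ⟩
  9 * 3 ^ suc n ∎
  where
  open ≡-Reasoning
  a = size (muxᶠ (s ∘ suc) (x ∘ (false ∷_)))
  b = size (muxᶠ (s ∘ suc) (x ∘ (true ∷_)))
  regroup : ∀ a b n → 4 * (a + (b + suc n) + (1 + b)) + 2 * suc n + 5 ≡
                      (4 * a + 2 * n + 5) + 2 * (4 * b + 2 * n + 5)
  regroup = ℕ-Solver.solve-∀
  collect : ∀ t → 9 * t + 2 * (9 * t) ≡ 9 * (3 * t)
  collect = ℕ-Solver.solve-∀

-- Normalised fractions hide a gcd, so the equation is carried to unnormalised rationals, where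
-- equality is cross-multiplication of integers.
size-bound-ℚ : ∀ k n t → 4 * k + 2 * n + 5 ≡ 9 * t →
  (+ k / 1) ≡ (+ 9 / 4) ℚ.* (+ t / 1) ℚ.- (+ n / 2) ℚ.- (+ 5 / 4)
size-bound-ℚ k n t eq = ℚ.toℚᵘ-injective (begin
  toℚᵘ (+ k / 1)
    ≈⟨ ℚ.toℚᵘ-fromℚᵘ (mkℚᵘ (+ k) 0) ⟩
  mkℚᵘ (+ k) 0
    -- The uncancelled denominator on the right is 4 · 1 · 2 · 4 = 32. Substituting for `9 * t`
    -- leaves a polynomial identity in `k` and `n`.
    ≈⟨ *≡* cleared ⟩
  mkℚᵘ (+ 9) 3 ℚᵘ.* mkℚᵘ (+ t) 0 ℚᵘ.- mkℚᵘ (+ n) 1 ℚᵘ.- mkℚᵘ (+ 5) 3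
    ≈⟨ ℚᵘ.+-cong (ℚᵘ.+-cong (ℚᵘ.*-cong (ℚ.toℚᵘ-fromℚᵘ (mkℚᵘ (+ 9) 3)) (ℚ.toℚᵘ-fromℚᵘ (mkℚᵘ (+ t) 0)))
                            (ℚᵘ.-‿cong (ℚ.toℚᵘ-fromℚᵘ (mkℚᵘ (+ n) 1))))
                 (ℚᵘ.-‿cong (ℚ.toℚᵘ-fromℚᵘ (mkℚᵘ (+ 5) 3))) ⟨
  toℚᵘ p ℚᵘ.* toℚᵘ q ℚᵘ.- toℚᵘ r ℚᵘ.- toℚᵘ u
    ≈⟨ ℚᵘ.+-cong (ℚᵘ.+-cong (ℚ.toℚᵘ-homo-* p q) (ℚ.toℚᵘ-homo‿- r)) (ℚ.toℚᵘ-homo‿- u) ⟨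
  toℚᵘ (p ℚ.* q) ℚᵘ.+ toℚᵘ (ℚ.- r) ℚᵘ.+ toℚᵘ (ℚ.- u)
    ≈⟨ ℚᵘ.+-cong (ℚ.toℚᵘ-homo-+ (p ℚ.* q) (ℚ.- r)) ℚᵘ.≃-refl ⟨
  toℚᵘ (p ℚ.* q ℚ.- r) ℚᵘ.+ toℚᵘ (ℚ.- u)
    ≈⟨ ℚ.toℚᵘ-homo-+ (p ℚ.* q ℚ.- r) (ℚ.- u) ⟨
  toℚᵘ (p ℚ.* q ℚ.- r ℚ.- u) ∎)
  where
  open import Relation.Binary.Reasoning.Setoid ℚᵘ.≃-setoid
  p = + 9 / 4
  q = + t / 1
  r = + n / 2
  u = + 5 / 4

  eqℤ : (+ 9) ℤ.* (+ t) ≡ (+ 4) ℤ.* (+ k) ℤ.+ (+ 2) ℤ.* (+ n) ℤ.+ (+ 5)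
  eqℤ = trans (sym (ℤ.pos-* 9 t)) (trans (cong +_ (sym eq))
    (cong (ℤ._+ + 5) (cong₂ ℤ._+_ (ℤ.pos-* 4 k) (ℤ.pos-* 2 n))))

  clear : ∀ k n → k ℤ.* (+ 32) ≡
    ((((+ 4) ℤ.* k ℤ.+ (+ 2) ℤ.* n ℤ.+ (+ 5)) ℤ.* (+ 2) ℤ.+ (ℤ.- n) ℤ.* (+ 4)) ℤ.* (+ 4)
      ℤ.+ (ℤ.- (+ 5)) ℤ.* (+ 8)) ℤ.* (+ 1)
  clear = ℤ-Solver.solve-∀

  cleared : (+ k) ℤ.* (+ 32) ≡
    (((+ 9) ℤ.* (+ t) ℤ.* (+ 2) ℤ.+ (ℤ.- (+ n)) ℤ.* (+ 4)) ℤ.* (+ 4)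
      ℤ.+ (ℤ.- (+ 5)) ℤ.* (+ 8)) ℤ.* (+ 1)
  cleared rewrite eqℤ = clear (+ k) (+ n)

theorem5p15 : ∀ (n : ℕ) → n ≥ 1 →
    Σ[ F ∈ Formula (n + 2 ^ n) ] (F IsHazardFreeFor MUX n
    × depth F ≡ 2 * n + 1
    × (+ size F / 1) ℚ.≤ (+ 9 / 4) ℚ.* (+ (3 ^ n) / 1) ℚ.- (+ n / 2) ℚ.- (+ 5 / 4))
theorem5p15 n@(suc _) _ =
  F , (computes , hazardFree) , depth-muxᶠ-suc s x ,
  ℚ.≤-reflexive (size-bound-ℚ (size F) n (3 ^ n) (size-muxᶠ s x))
  where
  s = λ i → i ↑ˡ 2 ^ n
  x = λ p → n ↑ʳ address p
  F = muxᶠ s x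

  hazardFree : ∀ α → eval F α ≡ hazardFreeExtension (MUX n) α
  hazardFree α = trans (eval-muxᶠ s x α) (sym (mux₃-hazardFree n α))

  computes : F Computes MUX n
  computes a = trans (hazardFree (map ⌜_⌝ a)) (hazardFreeExtension-⌜⌝ (MUX n) a)
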